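{- Let $1<k\in\mathbb{Z}$. To each $k$-germ $\alpha=a_{k-1}\cdots a_1$ corresponds a $(2k+1)$-string $F(\alpha)=f_0f_1\cdots f_{2k}$ whose entries are the numbers $0,1,\ldots,k$ (once each) together with $k$ asterisks $*$, and such that: (A) $F(0^{k-1})=012\cdots(k-2)(k-1)k*\cdots*$; (B) if $\alpha\ne 0^{k-1}$, with $a_i$ the rightmost nonzero entry of $\alpha$ ($k>i\ge 1$), then $F(\alpha)$ is obtained from $F(\beta(\alpha))=h_0h_1\cdots h_{2k}$ by the following Castling Procedure: 1. let $W^i=h_0h_1\cdots h_{i-1}$ and $Z^i=h_{2k-i+1}\cdots h_{2k-1}h_{2k}$ be respectively the initial and terminal substrings of length $i$ of $F(\beta(\alpha))$ (these are also the initial and terminal substrings of length $i$ of $F(\alpha)$); 2. let $\Omega>0$ be the leftmost entry of the substring $U$ obtained from $F(\beta(\alpha))$ by removing $W^i$ and $Z^i$, and write $U$ as the concatenation $U=X|Y$ with $Y$ starting at the entry $\Omega+1$, so that $F(\beta(\alpha))=W^i|X|Y|Z^i$; 3. set $F(\alpha)=W^i|Y|X|Z^i$. In particular: (a) the leftmost entry of each $F(\alpha)$ is $0$; $k*$ is a substring of $F(\alpha)$, but $*k$ is not; (b) a number to the immediate right of any $b\in\{0,\ldots,k-1\}$ in $F(\alpha)$ is larger than $b$; (c) for each $\alpha\neq 0^{k-1}$, $W^i$ is an ascending string of $i$ numbers and $Z^i$ is formed by $i$ of the $k$ asterisks.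
   Context: For $1<k\in\mathbb{Z}$, a $k$-germ is a $(k-1)$-string $\alpha=a_{k-1}a_{k-2}\cdots a_2a_1$ of nonnegative integers with $a_{k-1}\in\{0,1\}$ and $0\le a_{i-1}\le a_i+1$ for $1<i<k$. The null $k$-germ is $0^{k-1}=0\cdots 0$. For a $k$-germ $\alpha=a_{k-1}\cdots a_1\ne 0^{k-1}$ whose rightmost nonzero entry is $a_i$ (that is, $a_i\neq0$ and $a_j=0$ for all $j<i$), $\beta(\alpha)=b_{k-1}\cdots b_1$ denotes the $k$-germ with $b_i=a_i-1$ and $b_j=a_j$ for $j\ne i$. Iterating $\alpha\mapsto\beta(\alpha)$ eventually leads to $0^{k-1}$, so (A) and (B) define $F$ recursively. The bar $|$ denotes concatenation of strings; "substring" means a substring of consecutive entries. -}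

module Defs where

open import Data.Fin.Base as Fin using (Fin; toℕ)
import Data.Fin.Properties as Fin
open import Data.List.Base as List using (List; []; _∷_; _++_)
open import Data.List.Relation.Binary.Infix.Heterogeneous using (Infix)
open import Data.Maybe.Base using (just)
open import Data.Nat.Base
open import Data.Nat.Properties
open import Data.Product.Base using (∃; _×_; _,_)
open import Data.Vec.Base as Vec using (Vec; lookup; replicate; updateAt; toList)
open import Data.Vec.Properties using (lookup-replicate; lookup∘updateAt; lookup∘updateAt′)
open import Data.Vec.Relation.Binary.Pointwise.Extensional using (ext; Pointwise-≡⇒≡)
open import Relation.Binary.PropositionalEquality
open import Relation.Nullary.Decidable.Core using (yes; no)

-- Entries of a germ a_{k-1} ⋯ a_1 carry the indices 1, …, k-1.
index : ∀ {n} → Fin n → ℕ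
index i = suc (toℕ i)

-- The vector lists the entries by increasing index, a_1 first, so it is the
-- string a_{k-1} ⋯ a_1 read from right to left.  Validity is irrelevant:
-- germs with the same entries are definitionally equal.
record Germ (k : ℕ) : Set where
  constructor germ
  field
    entries  : Vec ℕ (k ∸ 1)
    .leading : ∀ i → suc (index i) ≡ k → lookup entries i ≤ 1
    .step    : ∀ i j → index j ≡ suc (index i) →
               lookup entries i ≤ lookup entries j + 1

open Germ public using (entries)

germ-≡ : ∀ {k} {α α′ : Germ k} → entries α ≡ entries α′ → α ≡ α′
germ-≡ refl = refl

nullGerm : ∀ k → Germ k
nullGerm k = germ (replicate (k ∸ 1) 0)
  (λ i _ → subst (_≤ 1) (sym (lookup-replicate i 0)) z≤n)
  (λ i _ _ → subst (_≤ _) (sym (lookup-replicate i 0)) z≤n)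

-- "Rightmost" in the string means of smallest index.
RightmostNonzero : ∀ {k} → Germ k → Fin (k ∸ 1) → Set
RightmostNonzero α i =
  lookup (entries α) i ≢ 0 × (∀ j → j Fin.< i → lookup (entries α) j ≡ 0)

rightmostNonzero : ∀ {k} (α : Germ k) → α ≢ nullGerm k → ∃ (RightmostNonzero α)
rightmostNonzero {k} α@(germ a _ _) α≢0 =
  let i , aᵢ≢0 , zeros = Fin.¬∀⟶∃¬-smallest (k ∸ 1) _ (λ i → lookup a i ≟ 0)
                           (λ a≡0 → α≢0 (null a≡0))
  in i , aᵢ≢0 , λ j j<i →
       subst (λ j → lookup a j ≡ 0)
             (Fin.toℕ-injective (trans (Fin.toℕ-inject (Fin.fromℕ< j<i)) (Fin.toℕ-fromℕ< j<i)))
             (zeros (Fin.fromℕ< j<i))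
  where
  null : (∀ i → lookup a i ≡ 0) → α ≡ nullGerm k
  null a≡0 = germ-≡ (Pointwise-≡⇒≡ (ext λ i → trans (a≡0 i) (sym (lookup-replicate i 0))))

lookup-pred-≤ : ∀ {n} (a : Vec ℕ n) i j → lookup (updateAt a i pred) j ≤ lookup a j
lookup-pred-≤ a i j with j Fin.≟ i
... | yes refl = ≤-trans (≤-reflexive (lookup∘updateAt i a)) pred[n]≤n
... | no  j≢i  = ≤-reflexive (lookup∘updateAt′ j i j≢i a)

β : ∀ {k} (α : Germ k) {i} → RightmostNonzero α i → Germ k
β (germ a leading step) {i} (_ , zeros) = germ (updateAt a i pred)
  (λ j top → ≤-trans (lookup-pred-≤ a i j) (leading j top))
  (λ j l l≡j+1 → step-pred j l l≡j+1 (step j l l≡j+1))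
  where
  step-pred : ∀ j l → index l ≡ suc (index j) → lookup a j ≤ lookup a l + 1 →
              lookup (updateAt a i pred) j ≤ lookup (updateAt a i pred) l + 1
  step-pred j l l≡j+1 aⱼ≤aₗ+1 with l Fin.≟ i
  ... | yes refl = ≤-trans (lookup-pred-≤ a i j)
                     (≤-trans (≤-reflexive (zeros j (≤-reflexive (sym (suc-injective l≡j+1))))) z≤n)
  ... | no  l≢i  = ≤-trans (lookup-pred-≤ a i j)
                     (≤-trans aⱼ≤aₗ+1
                       (≤-reflexive (cong (_+ 1) (sym (lookup∘updateAt′ l i l≢i a)))))

data Symbol : Set where
  num : ℕ → Symbol
  ∗   : Symbol

Substring : List Symbol → List Symbol → Set
Substring = Infix _≡_

initial terminal : ℕ → List Symbol → List Symbol
initial  i h = List.take i h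
terminal i h = List.drop (List.length h ∸ i) h

record Castling (i : ℕ) (h f : List Symbol) : Set where
  field
    Ω       : ℕ
    X Y     : List Symbol
    h≡WXYZ  : h ≡ initial i h ++ (X ++ Y) ++ terminal i h
    Ω>0     : Ω > 0
    U-head  : List.head (X ++ Y) ≡ just (num Ω)
    Y-head  : List.head Y ≡ just (num (suc Ω))
    f≡WYXZ  : f ≡ initial i h ++ (Y ++ X) ++ terminal i h

-- 0 1 2 ⋯ k ∗ ⋯ ∗
baseString : ℕ → List Symbol
baseString k = List.map num (List.upTo (suc k)) ++ List.replicate k ∗

-- Conditions (A) and (B) of the recursion defining F.
record CastlingRecursion (k : ℕ) (F : Germ k → Vec Symbol (suc (2 * k))) : Set where
  field
    base   : toList (F (nullGerm k)) ≡ baseString k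
    castle : ∀ α {i} (r : RightmostNonzero α i) →
             Castling (index i) (toList (F (β α r))) (toList (F α))

-- F has a closed form.  Put B_{k-1} = [k ∗], a list consisting of one block.  If
-- B_i has been built from a_{k-1}, …, a_{i+1}, split it as P|Q with Q made of its
-- last a_i blocks, and let B_{i-1} = Q | i P ∗, where i P ∗ is a single block.
-- Then F(α) is 0 followed by the blocks of B_0.  The germ condition says exactly
-- that B_i has at least a_i blocks, and the blocks of B_i start with consecutive
-- numbers descending to i + 1.  If a_j = 0 for all j < i, then
-- F(α) = 0 1 ⋯ (i-1) | B_{i-1} | ∗^{i-1}, and raising a_i by one moves the last
-- block of P to the front of Q, which is the castling.  Conversely a castling of
-- h is determined by h, since each number occurs in h only once.

module Submission where

open import Defs
open import Data.Nat.Base using (ℕ; suc; _*_; _<_)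
open import Data.List.Base as List using (List; []; _∷_)
open import Data.List.Relation.Binary.Permutation.Propositional using (_↭_)
open import Data.List.Relation.Unary.Linked using (Linked)
open import Data.Product.Base using (∃; _×_)
open import Data.Vec.Base using (Vec; head; toList)
open import Relation.Binary.PropositionalEquality using (_≡_)
open import Relation.Nullary.Negation.Core using (¬_)

open import Data.Empty using (⊥-elim)
open import Data.Fin.Base as Fin using (Fin)
open import Data.List.Base using (_++_; [_]; concat; take; drop; length; replicate; mapMaybe; upTo)
open import Data.List.Membership.Propositional using (_∈_)
open import Data.List.Properties hiding (≡-dec)
open import Data.List.Relation.Binary.Infix.Heterogeneous using (Infix; here; there; _++ⁱ_; _ⁱ++_)
open import Data.List.Relation.Binary.Permutation.Propositional
  using (↭-refl; ↭-sym; ↭-trans; ↭-prep; ↭-reflexive; ↭⇒↭ₛ; module PermutationReasoning)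
import Data.List.Relation.Binary.Permutation.Propositional.Properties as Perm
import Data.List.Relation.Binary.Permutation.Setoid.Properties as PermutationSetoid
open import Data.List.Relation.Binary.Prefix.Heterogeneous as Prefix using ()
open import Data.List.Relation.Unary.AllPairs using (_∷_)
open import Data.List.Relation.Unary.Any using (Any; here; there)
open import Data.List.Relation.Unary.Any.Properties using (++⁺ˡ; ++⁺ʳ; ++⁻)
open import Data.List.Relation.Unary.Linked using ([]; [-]; _∷_)
open import Data.List.Relation.Unary.Unique.Propositional using (Unique)
open import Data.List.Relation.Unary.Unique.Propositional.Properties using (upTo⁺; Unique[x∷xs]⇒x∉xs)
open import Data.Maybe.Base using (Maybe; just; nothing)
open import Data.Nat.Base using (zero; _+_; _∸_; _≤_; s<s; z<s; pred)
open import Data.Nat.Induction using (<-wellFounded; Acc; acc)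
open import Data.Nat.Properties
open import Data.Product.Base using (_,_; proj₁)
open import Data.Sum.Base using ([_,_]′)
open import Data.Unit.Base using (⊤; tt)
open import Data.Vec.Base as Vec using ([]; _∷_; lookup; updateAt)
open import Data.Vec.Properties using (≡-dec; cast-is-id; toList∘fromList; toList-cast; toList-injective)
open import Function.Base using (_∘_)
open import Relation.Binary.PropositionalEquality
  using (_≢_; refl; sym; trans; cong; cong₂; subst; subst₂; setoid; module ≡-Reasoning)
open import Relation.Nullary.Decidable.Core using (yes; no; recompute)

-- Lists: cutting at a known length, and linked lists

module _ {A : Set} where

  take-length-++ : ∀ (xs {ys} : List A) → take (length xs) (xs ++ ys) ≡ xs
  take-length-++ []       = refl
  take-length-++ (x ∷ xs) = cong (x ∷_) (take-length-++ xs)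

  drop-length-++ : ∀ (xs {ys} : List A) → drop (length xs) (xs ++ ys) ≡ ys
  drop-length-++ []       = refl
  drop-length-++ (x ∷ xs) = drop-length-++ xs

  length-++-∸ : ∀ (xs {ys} : List A) → length (xs ++ ys) ∸ length ys ≡ length xs
  length-++-∸ xs {ys} = trans (cong (_∸ length ys) (length-++ xs)) (m+n∸n≡m (length xs) (length ys))

  replicate-∷ʳ : ∀ n (x : A) → replicate n x ++ [ x ] ≡ x ∷ replicate n x
  replicate-∷ʳ zero    x = refl
  replicate-∷ʳ (suc n) x = cong (x ∷_) (replicate-∷ʳ n x)

  split-∷ : ∀ {a} (xs : List A) → a < length xs →
            ∃ λ P → ∃ λ x → ∃ λ Q → xs ≡ P ++ x ∷ Q × length Q ≡ a
  split-∷ {a} (x ∷ xs) a<len with a ≟ length xs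
  ... | yes refl = [] , x , xs , refl , refl
  ... | no a≢    =
    let P , y , Q , eq , |Q| = split-∷ xs (≤∧≢⇒< (≤-pred a<len) a≢)
    in x ∷ P , y , Q , cong (x ∷_) eq , |Q|

  linked-++⁻ˡ : ∀ {R : A → A → Set} xs {ys} → Linked R (xs ++ ys) → Linked R xs
  linked-++⁻ˡ []           _       = []
  linked-++⁻ˡ (x ∷ [])     _       = [-]
  linked-++⁻ˡ (x ∷ y ∷ xs) (r ∷ l) = r ∷ linked-++⁻ˡ (y ∷ xs) l

  linked-glue : ∀ {R : A → A → Set} xs {y ys} →
                Linked R (xs ++ [ y ]) → Linked R (y ∷ ys) → Linked R (xs ++ y ∷ ys)
  linked-glue []           _       l = l
  linked-glue (x ∷ [])     (r ∷ _) l = r ∷ l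
  linked-glue (x ∷ z ∷ xs) (r ∷ k) l = r ∷ linked-glue (z ∷ xs) k l

  linked-infix : ∀ {R : A → A → Set} {x y zs} → Linked R zs →
                 Infix _≡_ (x ∷ y ∷ []) zs → R x y
  linked-infix (r ∷ _) (here (refl Prefix.∷ (refl Prefix.∷ _))) = r
  linked-infix [-]     (here (_ Prefix.∷ ()))
  linked-infix (_ ∷ l) (there p) = linked-infix l p
  linked-infix [-]     (there (here ()))

Word : Set
Word = List Symbol

module _ {i : ℕ} (W U Z : Word) {h : Word} (h≡WUZ : h ≡ W ++ U ++ Z) where

  initial-≡ : length W ≡ i → initial i h ≡ W
  initial-≡ refl = trans (cong (take (length W)) h≡WUZ) (take-length-++ W)

  terminal-≡ : length Z ≡ i → terminal i h ≡ Z
  terminal-≡ refl = begin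
    drop (length h ∸ length Z) h                             ≡⟨ cong (λ h → drop (length h ∸ length Z) h) eq ⟩
    drop (length ((W ++ U) ++ Z) ∸ length Z) ((W ++ U) ++ Z) ≡⟨ cong (λ n → drop n ((W ++ U) ++ Z)) (length-++-∸ (W ++ U) {Z}) ⟩
    drop (length (W ++ U)) ((W ++ U) ++ Z)                   ≡⟨ drop-length-++ (W ++ U) ⟩
    Z                                                        ∎
    where
    open ≡-Reasoning
    eq : h ≡ (W ++ U) ++ Z
    eq = trans h≡WUZ (sym (++-assoc W U Z))

-- Blocks, the closed form of F, and its entries

block : ℕ → List Word → Word
block c bs = num c ∷ concat bs ++ [ ∗ ]

-- The passage from B_i to B_{i-1} for `c` = i. The truncated subtraction counts the blocks of P; it
-- gives 0, hence an empty P, when `a` exceeds `length bs`, so the formula makes sense for every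
-- vector.
nest : ℕ → ℕ → List Word → List Word
nest c a bs =
  drop (length bs ∸ a) bs ++ [ block c (take (length bs ∸ a) bs) ]

-- blocks j (a_{j+1} ∷ a_{j+2} ∷ ⋯) is the list B_j.
blocks : ∀ {n} → ℕ → Vec ℕ n → List Word
blocks j []       = [ block (suc j) [] ]
blocks j (a ∷ as) = nest (suc j) a (blocks (suc j) as)

word : ∀ {n} → Vec ℕ n → Word
word as = num 0 ∷ concat (blocks 0 as)

nest-++ : ∀ c P {Q} → nest c (length Q) (P ++ Q) ≡ Q ++ [ block c P ]
nest-++ c P {Q}
  rewrite length-++-∸ P {Q} | take-length-++ P {Q} | drop-length-++ P {Q} = refl

concat-∷ʳ : ∀ (bs : List Word) {b} → concat (bs ++ [ b ]) ≡ concat bs ++ b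
concat-∷ʳ bs {b} = trans (sym (concat-++ bs [ b ])) (cong (concat bs ++_) (++-identityʳ b))

nest-0 : ∀ c bs → nest c 0 bs ≡ [ block c bs ]
nest-0 c bs =
  cong₂ (λ bs′ bs″ → bs′ ++ [ block c bs″ ]) (drop-all (length bs) bs ≤-refl) (take-all (length bs) bs ≤-refl)

-- A zero entry leaves Q empty, so everything becomes one block. The zeros at indices below i thus
-- produce the numbers of W^i after 0 and all but one of the asterisks of Z^i.
concat-nest-0 : ∀ c bs → concat (nest c 0 bs) ≡ block c bs
concat-nest-0 c bs = trans (cong concat (nest-0 c bs)) (++-identityʳ (block c bs))

block-↭ : ∀ c bs → block c bs ↭ num c ∷ ∗ ∷ concat bs
block-↭ c bs = ↭-prep (num c) (Perm.++-comm (concat bs) [ ∗ ])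

-- The value of `a` only decides where `bs` is cut; the two pieces, once exchanged back, recombine
-- to `bs`.
nest-↭ : ∀ c a bs → concat (nest c a bs) ↭ num c ∷ ∗ ∷ concat bs
nest-↭ c a bs = begin
  concat (Q ++ [ block c P ])           ≡⟨ concat-∷ʳ Q ⟩
  concat Q ++ block c P                 ↭⟨ Perm.++-comm (concat Q) (block c P) ⟩
  block c P ++ concat Q                 ↭⟨ Perm.++⁺ʳ (concat Q) (block-↭ c P) ⟩
  num c ∷ ∗ ∷ concat P ++ concat Q      ≡⟨ cong (λ w → num c ∷ ∗ ∷ w) (concat-++ P Q) ⟩
  num c ∷ ∗ ∷ concat (P ++ Q)           ≡⟨ cong (λ bs → num c ∷ ∗ ∷ concat bs) (take++drop≡id (length bs ∸ a) bs) ⟩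
  num c ∷ ∗ ∷ concat bs                 ∎
  where
  open PermutationReasoning
  P = take (length bs ∸ a) bs
  Q = drop (length bs ∸ a) bs

-- By `nest-↭` the entries of a vector only influence the order of the symbols. Comparison with the
-- zero vector then yields `word-↭`.
blocks-↭ : ∀ {n} j (as bs : Vec ℕ n) → concat (blocks j as) ↭ concat (blocks j bs)
blocks-↭ j []       []       = ↭-refl
blocks-↭ j (a ∷ as) (b ∷ bs) = begin
  concat (nest (suc j) a (blocks (suc j) as))  ↭⟨ nest-↭ (suc j) a (blocks (suc j) as) ⟩
  num (suc j) ∷ ∗ ∷ concat (blocks (suc j) as) ↭⟨ ↭-prep _ (↭-prep _ (blocks-↭ (suc j) as bs)) ⟩
  num (suc j) ∷ ∗ ∷ concat (blocks (suc j) bs) ↭⟨ nest-↭ (suc j) b (blocks (suc j) bs) ⟨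
  concat (nest (suc j) b (blocks (suc j) bs))  ∎
  where open PermutationReasoning

-- `f` is characterised pointwise so that the induction can pass to `f ∘ suc`, to which `applyUpTo`
-- unfolds.
blocks-0 : ∀ n {f : ℕ → Symbol} j → (∀ m → f m ≡ num (m + suc j)) →
           concat (blocks j (Vec.replicate n 0)) ≡ List.applyUpTo f (suc n) ++ replicate (suc n) ∗
blocks-0 zero    {f} j f≡ = cong (_∷ [ ∗ ]) (sym (f≡ 0))
blocks-0 (suc n) {f} j f≡ = begin
  concat (nest (suc j) 0 (blocks (suc j) (Vec.replicate n 0)))
    ≡⟨ concat-nest-0 (suc j) (blocks (suc j) (Vec.replicate n 0)) ⟩
  num (suc j) ∷ concat (blocks (suc j) (Vec.replicate n 0)) ++ [ ∗ ]
    ≡⟨ cong₂ (λ x w → x ∷ w ++ [ ∗ ]) (sym (f≡ 0))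
         (blocks-0 n (suc j) (λ m → trans (f≡ (suc m)) (cong num (sym (+-suc m (suc j)))))) ⟩
  f 0 ∷ (List.applyUpTo (f ∘ suc) (suc n) ++ replicate (suc n) ∗) ++ [ ∗ ]
    ≡⟨ cong (f 0 ∷_) (++-assoc (List.applyUpTo (f ∘ suc) (suc n)) _ _) ⟩
  List.applyUpTo f (suc (suc n)) ++ replicate (suc n) ∗ ++ [ ∗ ]
    ≡⟨ cong (List.applyUpTo f (suc (suc n)) ++_) (replicate-∷ʳ (suc n) ∗) ⟩
  List.applyUpTo f (suc (suc n)) ++ replicate (suc (suc n)) ∗ ∎
  where open ≡-Reasoning

word-0 : ∀ n → word (Vec.replicate n 0) ≡ baseString (suc n)
word-0 n = begin
  num 0 ∷ concat (blocks 0 (Vec.replicate n 0))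
    ≡⟨ cong (num 0 ∷_) (blocks-0 n 0 (λ m → cong num (+-comm 1 m))) ⟩
  List.applyUpTo num (suc (suc n)) ++ replicate (suc n) ∗
    ≡⟨ cong (_++ replicate (suc n) ∗) (map-upTo num (suc (suc n))) ⟨
  baseString (suc n) ∎
  where open ≡-Reasoning

word-↭ : ∀ {n} (as : Vec ℕ n) → word as ↭ baseString (suc n)
word-↭ {n} as =
  ↭-trans (↭-prep (num 0) (blocks-↭ 0 as (Vec.replicate n 0))) (↭-reflexive (word-0 n))

length-baseString : ∀ k → length (baseString k) ≡ suc (2 * k)
length-baseString k = begin
  length (List.map num (upTo (suc k)) ++ replicate k ∗)
    ≡⟨ length-++ (List.map num (upTo (suc k))) ⟩
  length (List.map num (upTo (suc k))) + length (replicate k ∗)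
    ≡⟨ cong₂ _+_ (trans (length-map num (upTo (suc k))) (length-upTo (suc k))) (length-replicate k) ⟩
  suc k + k
    ≡⟨ cong (suc k +_) (+-identityʳ k) ⟨
  suc (2 * k) ∎
  where open ≡-Reasoning

length-word : ∀ {n} (as : Vec ℕ n) → length (word as) ≡ suc (2 * suc n)
length-word {n} as = trans (Perm.↭-length (word-↭ as)) (length-baseString (suc n))

-- Adjacent entries

-- The adjacencies allowed in F(α).  A number after an asterisk is less than k,
-- which is what excludes ∗ k.
data _⊢_↝_ (k : ℕ) : Symbol → Symbol → Set where
  ascent : ∀ {b c} → b < c → k ⊢ num b ↝ num c
  close  : ∀ {x} → k ⊢ x ↝ ∗
  open-∗ : ∀ {c} → c < k → k ⊢ ∗ ↝ num c

record Block (k c : ℕ) (b : Word) : Set where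
  constructor mkBlock
  field
    body   : Word
    b≡     : b ≡ num c ∷ body ++ [ ∗ ]
    linked : Linked (k ⊢_↝_) b

-- `c` is the first number of the last block, when there is one. Counting from the right suits
-- `nest`, which keeps a suffix and appends a block that starts one lower.
data Blocks (k c : ℕ) : List Word → Set where
  []  : Blocks k c []
  _∷_ : ∀ {b bs} → Block k (length bs + c) b → Blocks k c bs → Blocks k c (b ∷ bs)

module _ {k : ℕ} where

  blocks-++⁻ˡ : ∀ {c} P {Q} → Blocks k c (P ++ Q) → Blocks k (length Q + c) P
  blocks-++⁻ˡ []      _        = []
  blocks-++⁻ˡ {c} (b ∷ P) {Q} (x ∷ xs) =
    subst (λ d → Block k d b)
      (trans (cong (_+ c) (length-++ P)) (+-assoc (length P) (length Q) c)) x
    ∷ blocks-++⁻ˡ P xs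

  blocks-++⁻ʳ : ∀ {c} P {Q} → Blocks k c (P ++ Q) → Blocks k c Q
  blocks-++⁻ʳ []      xs       = xs
  blocks-++⁻ʳ (b ∷ P) (x ∷ xs) = blocks-++⁻ʳ P xs

  blocks-∷ʳ : ∀ {c bs b} → Blocks k (suc c) bs → Block k c b → Blocks k c (bs ++ [ b ])
  blocks-∷ʳ []                         y = y ∷ []
  blocks-∷ʳ {c} {b′ ∷ bs} {b} (x ∷ xs) y =
    subst (λ d → Block k d b′) root≡ x ∷ blocks-∷ʳ xs y
    where
    root≡ : length bs + suc c ≡ length (bs ++ [ b ]) + c
    root≡ = trans (sym (+-assoc (length bs) 1 c)) (cong (_+ c) (sym (length-++ bs)))

  -- At first `x` is the number of the enclosing block; in the recursion it is the asterisk closing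
  -- the previous block. The blocks left by then start below `length bs + c`, which is at most `k`,
  -- so `∗ k` cannot arise.
  linked-concat : ∀ {x c bs} → Blocks k c bs → length bs + c ≤ suc k →
                  (∀ {d} → c ≤ d → d < length bs + c → k ⊢ x ↝ num d) →
                  Linked (k ⊢_↝_) (x ∷ concat bs ++ [ ∗ ])
  linked-concat []                    _   _  = close ∷ [-]
  linked-concat {c = c} {b ∷ bs} (mkBlock w refl l ∷ xs) len≤ x↝ =
    subst (λ w → Linked (k ⊢_↝_) (_ ∷ num (length bs + c) ∷ w)) eq
      (x↝ (m≤n+m c (length bs)) ≤-refl ∷ linked-glue (num _ ∷ w) l
        (linked-concat xs (≤-trans (n≤1+n _) len≤) (λ _ d< → open-∗ (<-≤-trans d< (≤-pred len≤)))))
    where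
    eq : w ++ ∗ ∷ concat bs ++ [ ∗ ] ≡ ((w ++ [ ∗ ]) ++ concat bs) ++ [ ∗ ]
    eq = trans (sym (++-assoc w [ ∗ ] _)) (sym (++-assoc (w ++ [ ∗ ]) (concat bs) [ ∗ ]))

  linked-block : ∀ {b c bs} → Blocks k c bs → length bs + c ≤ suc k → b < c →
                 Linked (k ⊢_↝_) (block b bs)
  linked-block xs len≤ b<c = linked-concat xs len≤ (λ c≤d _ → ascent (<-≤-trans b<c c≤d))

  -- The suffix Q keeps its numbers, and the new block starts one below the last of `bs`. Inside it
  -- all blocks of P start above `c`, so `c` is followed by an ascent or by an asterisk. The length
  -- bound says that the first block starts with at most `k`.
  nest-Blocks : ∀ {c} a {bs} → Blocks k (suc c) bs → length bs + suc c ≤ suc k →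
                Blocks k c (nest c a bs) × length (nest c a bs) + c ≤ suc k
  nest-Blocks {c} a {bs} xs len≤ =
    blocks-∷ʳ (blocks-++⁻ʳ P xs′)
      (mkBlock (concat P) refl
        (linked-block (blocks-++⁻ˡ P xs′) (≤-trans (≤-reflexive P+Q) len≤) (m≤n+m (suc c) (length Q))))
    , ≤-trans (≤-reflexive |Q∷ʳ|) (≤-trans (m≤n+m _ (length P)) (≤-trans (≤-reflexive P+Q) len≤))
    where
    P = take (length bs ∸ a) bs
    Q = drop (length bs ∸ a) bs
    bs≡ = take++drop≡id (length bs ∸ a) bs
    xs′ : Blocks k (suc c) (P ++ Q)
    xs′ = subst (Blocks k (suc c)) (sym bs≡) xs
    P+Q : length P + (length Q + suc c) ≡ length bs + suc c
    P+Q = trans (sym (+-assoc (length P) (length Q) (suc c)))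
            (cong (_+ suc c) (trans (sym (length-++ P)) (cong length bs≡)))
    |Q∷ʳ| : ∀ {b} → length (Q ++ [ b ]) + c ≡ length Q + suc c
    |Q∷ʳ| = trans (cong (_+ c) (length-++ Q)) (+-assoc (length Q) 1 c)

  blocks-Blocks : ∀ {n} j (as : Vec ℕ n) → j + suc n ≡ k →
                  Blocks k (suc j) (blocks j as) × length (blocks j as) + suc j ≤ suc k
  blocks-Blocks j [] j+1≡k =
    mkBlock [] refl (close ∷ [-]) ∷ [] , ≤-reflexive (cong suc (trans (+-comm 1 j) j+1≡k))
  blocks-Blocks j (a ∷ as) j+n≡k =
    let xs , len≤ = blocks-Blocks (suc j) as (trans (sym (+-suc j _)) j+n≡k)
    in nest-Blocks a xs len≤

word-linked : ∀ {n} (as : Vec ℕ n) → Linked (suc n ⊢_↝_) (word as)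
word-linked as =
  let xs , len≤ = blocks-Blocks 0 as refl
  -- `word as` followed by one more asterisk is a block with number 0 around B_0.
  in linked-++⁻ˡ (word as) (linked-block xs len≤ z<s)

-- The substring k ∗

infix-concat : ∀ {p : Word} {bs} → Any (Substring p) bs → Substring p (concat bs)
infix-concat (here p)               = p ⁱ++ _
infix-concat {bs = b ∷ _} (there p) = b ++ⁱ infix-concat p

-- Nesting never cuts a block: a block of Q survives as it is, and a block of P lies inside the new
-- one.
nest-infix : ∀ {p} c a bs → Any (Substring p) bs → Any (Substring p) (nest c a bs)
nest-infix {p} c a bs p∈bs =
  [ (λ p∈P → ++⁺ʳ Q (here (there (infix-concat p∈P ⁱ++ [ ∗ ])))) , ++⁺ˡ ]′
    (++⁻ P (subst (Any (Substring p)) (sym (take++drop≡id (length bs ∸ a) bs)) p∈bs))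
  where
  P = take (length bs ∸ a) bs
  Q = drop (length bs ∸ a) bs

blocks-infix : ∀ {k n} j (as : Vec ℕ n) → j + suc n ≡ k →
               Any (Substring (num k ∷ ∗ ∷ [])) (blocks j as)
blocks-infix j []       refl  =
  here (here (cong num (+-comm j 1) Prefix.∷ (refl Prefix.∷ Prefix.[])))
blocks-infix j (a ∷ as) j+n≡k =
  nest-infix (suc j) a (blocks (suc j) as) (blocks-infix (suc j) as (trans (sym (+-suc j _)) j+n≡k))

-- The germ condition as a bound on the number of blocks

-- The length of blocks j as when the entries as come from a germ.
width : ∀ {n} → Vec ℕ n → ℕ
width []       = 1
width (a ∷ as) = suc a

-- One inequality covers both germ conditions: `width` is 1 on the empty vector, which bounds
-- a_{k-1}, and a_i + 1 on a vector starting with a_i.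
Bounded : ∀ {n} → Vec ℕ n → Set
Bounded []       = ⊤
Bounded (a ∷ as) = a ≤ width as × Bounded as

bounded : ∀ {n} (as : Vec ℕ n) →
          .(∀ i → suc (index i) ≡ suc n → lookup as i ≤ 1) →
          .(∀ i j → index j ≡ suc (index i) → lookup as i ≤ lookup as j + 1) →
          Bounded as
bounded []       leading step = tt
bounded (a ∷ as) leading step =
  -- The germ conditions are irrelevant arguments; decidability of the inequality turns it into a
  -- relevant proof.
  recompute (a ≤? width as) (a≤ as leading step)
  , bounded as (λ i top → leading (Fin.suc i) (cong suc top))
               (λ i j j≡i+1 → step (Fin.suc i) (Fin.suc j) (cong suc j≡i+1))
  where
  a≤ : ∀ {n a} (as : Vec ℕ n) →
       (∀ i → suc (index i) ≡ suc (suc n) → lookup (a ∷ as) i ≤ 1) →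
       (∀ i j → index j ≡ suc (index i) → lookup (a ∷ as) i ≤ lookup (a ∷ as) j + 1) →
       a ≤ width as
  a≤ []       leading step = leading Fin.zero refl
  a≤ (b ∷ as) leading step =
    ≤-trans (step Fin.zero (Fin.suc Fin.zero) refl) (≤-reflexive (+-comm b 1))

-- The new list consists of Q and one further block. The germ condition guarantees that Q really has
-- `a` blocks, as the truncated subtraction is then exact.
length-blocks : ∀ {n} j (as : Vec ℕ n) → Bounded as → length (blocks j as) ≡ width as
length-blocks j []       _          = refl
length-blocks j (a ∷ as) (a≤ , bas) = begin
  length (drop (length bs ∸ a) bs ++ [ _ ])     ≡⟨ length-++ (drop (length bs ∸ a) bs) ⟩
  length (drop (length bs ∸ a) bs) + 1          ≡⟨ cong (_+ 1) (length-drop (length bs ∸ a) bs) ⟩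
  length bs ∸ (length bs ∸ a) + 1               ≡⟨ cong (_+ 1) (m∸[m∸n]≡n a≤len) ⟩
  a + 1                                         ≡⟨ +-comm a 1 ⟩
  suc a                                         ∎
  where
  open ≡-Reasoning
  bs = blocks (suc j) as
  a≤len : a ≤ length bs
  a≤len = ≤-trans a≤ (≤-reflexive (sym (length-blocks (suc j) as bas)))

-- Castlings of the closed form

-- A castling of ℓ h into ℓ f, where the number ℓ precedes both words and belongs
-- to W^i; it is left out so that castlings can be nested.
record CastlingAt (ℓ i : ℕ) (h f : Word) : Set where
  field
    w       : List ℕ
    |w|     : length (ℓ ∷ w) ≡ i
    w-asc   : Linked _<_ (ℓ ∷ w)
    Ω       : ℕ
    X Y     : Word
    Ω>0     : 0 < Ω
    U-head  : List.head (X ++ Y) ≡ just (num Ω)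
    Y-head  : List.head Y ≡ just (num (suc Ω))
    h≡WXYZ  : h ≡ List.map num w ++ (X ++ Y) ++ replicate i ∗
    f≡WYXZ  : f ≡ List.map num w ++ (Y ++ X) ++ replicate i ∗

-- With i = j + 1 the two words are Q | i P B ∗ and B | Q | i P ∗. Hence X is Q i P, Y is `B`, and Z
-- is the last asterisk.
nest-castling : ∀ {k} j P B Q → Blocks k (suc (suc j)) (P ++ B ∷ Q) →
  CastlingAt j 1 (concat (nest (suc j) (length Q) (P ++ B ∷ Q)))
                 (concat (nest (suc j) (suc (length Q)) (P ++ B ∷ Q)))
nest-castling j P B Q xs with blocks-++⁻ʳ P xs
... | mkBlock body refl _ ∷ ys = record
  { w = [] ; |w| = refl ; w-asc = [-]
  -- The number that starts `Q`, or i itself if `Q` is empty, since X then starts with i. As block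
  -- numbers are consecutive, `B` starts with the next one.
  ; Ω = length Q + suc j
  ; X = concat Q ++ num (suc j) ∷ concat P
  ; Y = B
  ; Ω>0 = m≤n⇒m≤o+n (length Q) z<s
  ; U-head = U-head ys
  ; Y-head = cong (just ∘ num) (+-suc (length Q) (suc j))
  ; h≡WXYZ = begin
      concat (nest (suc j) (length Q) (P ++ B ∷ Q))
        ≡⟨ cong (λ bs → concat (nest (suc j) (length Q) bs)) (++-assoc P [ B ] Q) ⟨
      concat (nest (suc j) (length Q) ((P ++ [ B ]) ++ Q))
        ≡⟨ cong concat (nest-++ (suc j) (P ++ [ B ]) {Q}) ⟩
      concat (Q ++ [ block (suc j) (P ++ [ B ]) ])
        ≡⟨ concat-∷ʳ Q ⟩
      concat Q ++ num (suc j) ∷ concat (P ++ [ B ]) ++ [ ∗ ]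
        ≡⟨ cong (λ w → concat Q ++ num (suc j) ∷ w ++ [ ∗ ]) (concat-∷ʳ P) ⟩
      concat Q ++ (num (suc j) ∷ concat P ++ B) ++ [ ∗ ]
        ≡⟨ ++-assoc (concat Q) (num (suc j) ∷ concat P ++ B) [ ∗ ] ⟨
      (concat Q ++ num (suc j) ∷ concat P ++ B) ++ [ ∗ ]
        ≡⟨ cong (_++ [ ∗ ]) (++-assoc (concat Q) (num (suc j) ∷ concat P) B) ⟨
      ((concat Q ++ num (suc j) ∷ concat P) ++ B) ++ [ ∗ ] ∎
  ; f≡WYXZ = begin
      concat (nest (suc j) (suc (length Q)) (P ++ B ∷ Q))
        ≡⟨ cong concat (nest-++ (suc j) P {B ∷ Q}) ⟩
      concat (B ∷ Q ++ [ block (suc j) P ])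
        ≡⟨ cong (B ++_) (concat-∷ʳ Q) ⟩
      B ++ concat Q ++ num (suc j) ∷ concat P ++ [ ∗ ]
        ≡⟨ cong (B ++_) (++-assoc (concat Q) (num (suc j) ∷ concat P) [ ∗ ]) ⟨
      B ++ (concat Q ++ num (suc j) ∷ concat P) ++ [ ∗ ]
        ≡⟨ ++-assoc B _ [ ∗ ] ⟨
      (B ++ concat Q ++ num (suc j) ∷ concat P) ++ [ ∗ ] ∎
  }
  where
  open ≡-Reasoning
  U-head : ∀ {k Q w w′} → Blocks k (suc (suc j)) Q →
           List.head ((concat Q ++ num (suc j) ∷ w) ++ w′) ≡ just (num (length Q + suc j))
  U-head []                        = refl
  U-head (_∷_ {bs = Q} (mkBlock _ refl _) _) = cong (just ∘ num) (+-suc (length Q) (suc j))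

-- The enclosing block puts its number on the left and its asterisk on the right, so W^i and Z^i
-- each grow by one while X and Y stay.
castlingAt-suc : ∀ {ℓ i h f} → CastlingAt (suc ℓ) i h f →
                 CastlingAt ℓ (suc i) (num (suc ℓ) ∷ h ++ [ ∗ ]) (num (suc ℓ) ∷ f ++ [ ∗ ])
castlingAt-suc {ℓ} {i} c = record
  { w = suc ℓ ∷ w ; |w| = cong suc |w| ; w-asc = n<1+n ℓ ∷ w-asc
  ; Ω = Ω ; X = X ; Y = Y ; Ω>0 = Ω>0 ; U-head = U-head ; Y-head = Y-head
  ; h≡WXYZ = cong (num (suc ℓ) ∷_) (enclose (X ++ Y) h≡WXYZ)
  ; f≡WYXZ = cong (num (suc ℓ) ∷_) (enclose (Y ++ X) f≡WYXZ)
  }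
  where
  open CastlingAt c
  enclose : ∀ {v} U → v ≡ List.map num w ++ U ++ replicate i ∗ →
            v ++ [ ∗ ] ≡ List.map num w ++ U ++ replicate (suc i) ∗
  enclose U refl = begin
    (List.map num w ++ U ++ replicate i ∗) ++ [ ∗ ]  ≡⟨ ++-assoc (List.map num w) _ _ ⟩
    List.map num w ++ (U ++ replicate i ∗) ++ [ ∗ ]  ≡⟨ cong (List.map num w ++_) (++-assoc U _ _) ⟩
    List.map num w ++ U ++ replicate i ∗ ++ [ ∗ ]    ≡⟨ cong (λ Z → List.map num w ++ U ++ Z) (replicate-∷ʳ i ∗) ⟩
    List.map num w ++ U ++ replicate (suc i) ∗       ∎
    where open ≡-Reasoning

-- Recursion over the zeros at indices below i: by `concat-nest-0` each one wraps a block around the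
-- castling for the remaining vector. At the nonzero entry itself `nest-castling` applies.
blocks-castling : ∀ {n} j (as : Vec ℕ n) i → Bounded as →
  lookup as i ≢ 0 → (∀ l → l Fin.< i → lookup as l ≡ 0) →
  CastlingAt j (index i) (concat (blocks j (updateAt as i pred))) (concat (blocks j as))
blocks-castling j (zero  ∷ as) Fin.zero _ a≢0 _ = ⊥-elim (a≢0 refl)
blocks-castling j (suc a ∷ as) Fin.zero (a< , bas) _ _
  with blocks (suc j) as | length-blocks (suc j) as bas
     | proj₁ (blocks-Blocks (suc j) as refl)
-- By the germ condition there are at least `suc a` blocks, so besides the `a` blocks of `Q` there
-- is a block `B` left to move.
... | bs | |bs| | xs with split-∷ bs (≤-trans a< (≤-reflexive (sym |bs|)))
... | P , B , Q , refl , refl = nest-castling j P B Q xs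
blocks-castling j (suc a ∷ as) (Fin.suc i) _ _ zeros with () ← zeros Fin.zero z<s
blocks-castling j (zero ∷ as) (Fin.suc i) (_ , bas) aᵢ≢0 zeros =
  subst₂ (CastlingAt j (suc (index i)))
    (sym (concat-nest-0 (suc j) (blocks (suc j) (updateAt as i pred))))
    (sym (concat-nest-0 (suc j) (blocks (suc j) as)))
    (castlingAt-suc (blocks-castling (suc j) as i bas aᵢ≢0 (λ l l<i → zeros (Fin.suc l) (s<s l<i))))

-- Uniqueness of castlings and of F

num? : Symbol → Maybe ℕ
num? (num c) = just c
num? ∗       = nothing

nums : Word → List ℕ
nums = mapMaybe num?

num∈nums : ∀ X {c Y} → c ∈ nums (X ++ num c ∷ Y)
num∈nums []          = here refl
num∈nums (num _ ∷ X) = there (num∈nums X)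
num∈nums (∗ ∷ X)     = num∈nums X

Unique-nums-tail : ∀ x {X} → Unique (nums (x ∷ X)) → Unique (nums X)
Unique-nums-tail (num _) (_ ∷ u) = u
Unique-nums-tail ∗       u       = u

-- If one prefix ended before the other, `c` would occur at that place and again further right.
split-unique : ∀ {c Y Y′} X X′ → Unique (nums (X ++ num c ∷ Y)) →
               X ++ num c ∷ Y ≡ X′ ++ num c ∷ Y′ → X ≡ X′ × Y ≡ Y′
split-unique []      []        _ refl = refl , refl
split-unique []      (_ ∷ X′)  u refl = ⊥-elim (Unique[x∷xs]⇒x∉xs u (num∈nums X′))
split-unique (_ ∷ X) []        u refl = ⊥-elim (Unique[x∷xs]⇒x∉xs u (num∈nums X))
split-unique (x ∷ X) (x′ ∷ X′) u eq with ∷-injectiveˡ eq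
... | refl with split-unique X X′ (Unique-nums-tail x {X ++ _} u) (∷-injectiveʳ eq)
...   | refl , Y≡Y′ = refl , Y≡Y′

nums-baseString : ∀ k → nums (baseString k) ≡ upTo (suc k)
nums-baseString k = begin
  nums (List.map num (upTo (suc k)) ++ replicate k ∗)
    ≡⟨ mapMaybe-++ num? (List.map num (upTo (suc k))) (replicate k ∗) ⟩
  nums (List.map num (upTo (suc k))) ++ nums (replicate k ∗)
    ≡⟨ cong₂ _++_ (mapMaybe-map-retract {proj = num?} {emb = num} (λ _ → refl) (upTo (suc k))) (nums-∗ k) ⟩
  upTo (suc k) ++ []
    ≡⟨ ++-identityʳ (upTo (suc k)) ⟩
  upTo (suc k) ∎
  where
  open ≡-Reasoning
  nums-∗ : ∀ n → nums (replicate n ∗) ≡ []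
  nums-∗ zero    = refl
  nums-∗ (suc n) = nums-∗ n

Unique-nums : ∀ {k h} → h ↭ baseString k → Unique (nums h)
Unique-nums {k} h↭ =
  PermutationSetoid.Unique-resp-↭ (setoid ℕ) (↭⇒↭ₛ (↭-sym (Perm.mapMaybe-↭ num? h↭)))
    (subst Unique (sym (nums-baseString k)) (upTo⁺ (suc k)))

-- `W` and `Z` depend only on `i` and `h`, so U is determined. Its head gives Ω, and the only
-- occurrence of Ω + 1 in `h` fixes the cut between X and Y.
castling-unique : ∀ {k i h f f′} → h ↭ baseString k → Castling i h f → Castling i h f′ → f ≡ f′
castling-unique {k} {i} {h} h↭ C C′ = go C C′
  where
  W = initial i h
  Z = terminal i h

  factor : ∀ X {Y y Ys} → Y ≡ y ∷ Ys → h ≡ W ++ (X ++ Y) ++ Z → h ≡ (W ++ X) ++ y ∷ Ys ++ Z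
  factor X refl h≡ = trans h≡ (trans (cong (W ++_) (++-assoc X _ Z)) (sym (++-assoc W X _)))

  head-∷ : ∀ {Y : Word} {y} → List.head Y ≡ just y → ∃ λ Ys → Y ≡ y ∷ Ys
  head-∷ {_ ∷ Ys} refl = Ys , refl

  go : ∀ {f f′} → Castling i h f → Castling i h f′ → f ≡ f′
  go record { Ω = Ω ; X = X ; Y = Y ; h≡WXYZ = h≡ ; U-head = Uh ; Y-head = Yh ; f≡WYXZ = f≡ }
     record { Ω = Ω′ ; X = X′ ; Y = Y′ ; h≡WXYZ = h≡′ ; U-head = Uh′ ; Y-head = Yh′ ; f≡WYXZ = f≡′ }
    with ++-cancelʳ Z (X ++ Y) (X′ ++ Y′) (++-cancelˡ W _ _ (trans (sym h≡) h≡′))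
  ... | U≡U′ with trans (sym Uh) (trans (cong List.head U≡U′) Uh′) | head-∷ Yh | head-∷ Yh′
  ... | refl | Ys , refl | Ys′ , refl
    with split-unique (W ++ X) (W ++ X′)
           (subst (Unique ∘ nums) (factor X refl h≡) (Unique-nums {k} h↭))
           (trans (sym (factor X refl h≡)) (factor X′ refl h≡′))
  ... | WX≡WX′ , YZ≡Y′Z
    with ++-cancelˡ W X X′ WX≡WX′ | ++-cancelʳ Z Ys Ys′ YZ≡Y′Z
  ... | refl | refl = trans f≡ (sym f≡′)

sum-updateAt-pred : ∀ {n} (as : Vec ℕ n) i → lookup as i ≢ 0 → Vec.sum (updateAt as i pred) < Vec.sum as
sum-updateAt-pred (zero  ∷ as) Fin.zero    a≢0 = ⊥-elim (a≢0 refl)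
sum-updateAt-pred (suc a ∷ as) Fin.zero    _   = ≤-refl
sum-updateAt-pred (a ∷ as)     (Fin.suc i) a≢0 = +-monoʳ-< a (sum-updateAt-pred as i a≢0)

-- Well-founded induction on the sum of the entries, which `β` lowers. By induction `F` and `G`
-- agree on `β α`, so their castlings start from the same word and `castling-unique` applies.
castlingRecursion-unique : ∀ {k F G} → (∀ α → toList (F α) ↭ baseString k) →
                           CastlingRecursion k F → CastlingRecursion k G → ∀ α → G α ≡ F α
castlingRecursion-unique {k} {F} {G} F↭ RF RG α =
  trans (sym (cast-is-id refl (G α))) (toList-injective refl (G α) (F α) (go α (<-wellFounded _)))
  where
  open CastlingRecursion
  go : ∀ α → Acc _<_ (Vec.sum (entries α)) → toList (G α) ≡ toList (F α)
  go α (acc rec) with ≡-dec _≟_ (entries α) (entries (nullGerm k))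
  ... | yes α≡0 with refl ← germ-≡ {α = α} {nullGerm k} α≡0 = trans (base RG) (sym (base RF))
  ... | no α≢0 =
    let i , r = rightmostNonzero α (α≢0 ∘ cong entries)
        G≡F = go (β α r) (rec (sum-updateAt-pred (entries α) i (proj₁ r)))
    in castling-unique {k} (F↭ (β α r))
         (subst (λ h → Castling (index i) h (toList (G α))) G≡F (castle RG α r))
         (castle RF α r)

-- From castlings of the closed form to the theorem

module _ {i : ℕ} {h f : Word} (c : CastlingAt 0 i h f) where

  open CastlingAt c

  private
    h⁺ f⁺ W Z : Word
    h⁺ = num 0 ∷ h
    f⁺ = num 0 ∷ f
    W  = List.map num (0 ∷ w)
    Z  = replicate i ∗

    h⁺≡ : h⁺ ≡ W ++ (X ++ Y) ++ Z
    h⁺≡ = cong (num 0 ∷_) h≡WXYZ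

    f⁺≡ : f⁺ ≡ W ++ (Y ++ X) ++ Z
    f⁺≡ = cong (num 0 ∷_) f≡WYXZ

    |W| : length W ≡ i
    |W| = trans (length-map num (0 ∷ w)) |w|

    initial-h : initial i h⁺ ≡ W
    initial-h = initial-≡ W (X ++ Y) Z h⁺≡ |W|

    terminal-h : terminal i h⁺ ≡ Z
    terminal-h = terminal-≡ W (X ++ Y) Z h⁺≡ (length-replicate i)

    outer : ∀ U → W ++ U ++ Z ≡ initial i h⁺ ++ U ++ terminal i h⁺
    outer U = cong₂ (λ W Z → W ++ U ++ Z) (sym initial-h) (sym terminal-h)

  -- With the leading 0 restored, `W` and `Z` both have length `i`, so they are exactly what
  -- `initial` and `terminal` cut off `h⁺`.
  castlingAt⇒Castling : Castling i h⁺ f⁺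
  castlingAt⇒Castling = record
    { Ω = Ω ; X = X ; Y = Y ; Ω>0 = Ω>0 ; U-head = U-head ; Y-head = Y-head
    ; h≡WXYZ = trans h⁺≡ (outer (X ++ Y)) ; f≡WYXZ = trans f⁺≡ (outer (Y ++ X))
    }

  castlingAt⇒outer :
    initial i f⁺ ≡ initial i h⁺
    × terminal i f⁺ ≡ terminal i h⁺
    × (∃ λ (w : List ℕ) → length w ≡ i × Linked _<_ w × initial i h⁺ ≡ List.map num w)
    × terminal i h⁺ ≡ Z
  castlingAt⇒outer =
    trans (initial-≡ W (Y ++ X) Z f⁺≡ |W|) (sym initial-h)
    , trans (terminal-≡ W (Y ++ X) Z f⁺≡ (length-replicate i)) (sym terminal-h)
    , (0 ∷ w , |w| , w-asc , initial-h)
    , terminal-h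

theorem2 : ∀ (k : ℕ) → 1 < k →
    ∃ λ (F : Germ k → Vec Symbol (suc (2 * k))) →
    CastlingRecursion k F
    × (∀ G → CastlingRecursion k G → ∀ α → G α ≡ F α)
    × (∀ α → toList (F α) ↭ baseString k)
    × (∀ α → head (F α) ≡ num 0
    × Substring (num k ∷ ∗ ∷ []) (toList (F α))
    × ¬ Substring (∗ ∷ num k ∷ []) (toList (F α)))
    × (∀ α b c → b < k → Substring (num b ∷ num c ∷ []) (toList (F α)) → b < c)
    × (∀ α {i} (r : RightmostNonzero α i) →
    let f = toList (F α)
        h = toList (F (β α r))
    in initial (index i) f ≡ initial (index i) h
    × terminal (index i) f ≡ terminal (index i) h
    × (∃ λ (w : List ℕ) → List.length w ≡ index i
    × Linked _<_ w
    × initial (index i) h ≡ List.map num w)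
    × terminal (index i) h ≡ List.replicate (index i) ∗)
theorem2 k@(suc n) _ =
  F , recursion , (λ _ R → castlingRecursion-unique F↭ recursion R) , F↭
  -- Every `word` begins with `num 0`, and `cast` and `fromList` keep the first symbol
  -- definitionally.
  , (λ α → refl
         , subst (Substring _) (sym (toList-F α)) (there (infix-concat (blocks-infix 0 (entries α) refl)))
         , λ p → ∗k-absent (adjacent α p))
  , (λ α _ _ _ p → ascending (adjacent α p))
  , λ α {i} r →
      subst₂ (λ h f → initial (index i) f ≡ initial (index i) h
                    × terminal (index i) f ≡ terminal (index i) h
                    × (∃ λ (w : List ℕ) → length w ≡ index i × Linked _<_ w
                                        × initial (index i) h ≡ List.map num w)
                    × terminal (index i) h ≡ replicate (index i) ∗)
        (sym (toList-F (β α r))) (sym (toList-F α)) (castlingAt⇒outer (castling α r))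
  where
  F : Germ k → Vec Symbol (suc (2 * k))
  F α = Vec.cast (length-word (entries α)) (Vec.fromList (word (entries α)))

  toList-F : ∀ α → toList (F α) ≡ word (entries α)
  toList-F α = trans (toList-cast (length-word (entries α)) (Vec.fromList (word (entries α)))) (toList∘fromList (word (entries α)))

  F↭ : ∀ α → toList (F α) ↭ baseString k
  F↭ α = subst (_↭ baseString k) (sym (toList-F α)) (word-↭ (entries α))

  castling : ∀ α {i} → RightmostNonzero α i →
             CastlingAt 0 (index i) (concat (blocks 0 (updateAt (entries α) i pred)))
                                    (concat (blocks 0 (entries α)))
  castling (germ as leading step) {i} (aᵢ≢0 , zeros) =
    blocks-castling 0 as i (bounded as leading step) aᵢ≢0 zeros

  recursion : CastlingRecursion k F
  recursion = record
    { base   = trans (toList-F (nullGerm k)) (word-0 n)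
    ; castle = λ α r → subst₂ (Castling _) (sym (toList-F (β α r))) (sym (toList-F α))
                         (castlingAt⇒Castling (castling α r))
    }

  adjacent : ∀ α {x y} → Substring (x ∷ y ∷ []) (toList (F α)) → k ⊢ x ↝ y
  adjacent α p = linked-infix (word-linked (entries α)) (subst (Substring _) (toList-F α) p)

  ∗k-absent : ¬ (k ⊢ ∗ ↝ num k)
  ∗k-absent (open-∗ k<k) = <-irrefl refl k<k

  ascending : ∀ {b c} → k ⊢ num b ↝ num c → b < c
  ascending (ascent b<c) = b<c
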